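{- Let $A$ be a semiring, let $B$ be a non-empty subset of $A$ and let $n\ge 2$ be an integer. Then: (1) The partially ordered set $(\mathcal{E}_p(2^{A\supset B})_n,\subset)$ (ordered by inclusion) contains maximal elements. (2) $\mathcal{E}_p(2^{A\supset B})_n\cap\mathcal{F}_{ue}(A)_n\neq\emptyset$. Moreover, an element $D\in\mathcal{E}_p(2^{A\supset B})_n$ is maximal (with respect to inclusion in $\mathcal{E}_p(2^{A\supset B})_n$) if and only if $D\in\mathcal{E}_p(2^{A\supset B})_n\cap\mathcal{F}_{ue}(A)_n$.
   Context: A semiring $(A,+,\cdot)$ is associative, with a zero element $0$; multiplication need not be commutative and a multiplicative identity $1$ need not exist (if $1\in A$ then $0\ne 1$). For a non-empty $C\subset A$ and $n\ge 1$, $nC=\{c_1+\cdots+c_n: c_1,\dots,c_n\in C\}$ is the $n$-fold sumset. For non-empty subsets $B,C\subset A$ and $n\ge 2$, write $B\gtrdot\Rightarrow_n C$ if $B\supset C$, $nB=nC$, and the following property holds: (FP) for every $b\in B$ there are $k\ge1$ and $c_1,\dots,c_k\in C$ with $b=c_1\cdots c_k$. For non-empty $B\subset A$, $\mathcal{E}_p(2^{A\supset B})_n=\{D\subset A: D\gtrdot\Rightarrow_n B\}$ (it always contains $B$). A non-empty subset $B$ is called $n$-th sum-factor unexpanded if $\mathcal{E}_p(2^{A\supset B})_n=\{B\}$, and $\mathcal{F}_{ue}(A)_n$ denotes the set of all $n$-th sum-factor unexpanded subsets of $A$. -}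

module Defs where

open import Level using (Level; _⊔_; suc)
open import Algebra.Bundles using (SemiringWithoutOne)
open import Algebra.Definitions using (Identity)
open import Algebra.Definitions.RawMonoid using (sum)
open import Data.List.NonEmpty using (List⁺; foldr₁)
open import Data.List.NonEmpty.Relation.Unary.All using (All)
open import Data.Nat.Base using (ℕ)
open import Data.Product.Base using (Σ; ∃; ∃-syntax; _×_; _,_; proj₁)
open import Data.Vec.Functional using (Vector)
open import Function.Bundles using (_⇔_)
open import Relation.Binary.Bundles using (Poset)
open import Relation.Binary.Definitions using (_Respects_)
open import Relation.Nullary.Negation.Core using (¬_)
open import Relation.Unary using (Pred; Satisfiable; _∈_; _⊆_; _⊇_; _≐_)
open import Relation.Unary.Relation.Binary.Subset using (⊆-poset)
import Relation.Binary.Construct.On as On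

Maximal : ∀ {a ℓ₁ ℓ₂} (P : Poset a ℓ₁ ℓ₂) → Pred (Poset.Carrier P) (a ⊔ ℓ₁ ⊔ ℓ₂)
Maximal P x = ∀ y → x ≤ y → x ≈ y
  where open Poset P

-- `SemiringWithoutOne` has commutative, associative addition with neutral
-- element 0#, associative multiplication distributing over addition, and 0#
-- absorbing. An element that happens to be a multiplicative identity is
-- required to differ from 0#, which rules out exactly the one-element semiring.
UnitNonZero : ∀ {c ℓ} → SemiringWithoutOne c ℓ → Set (c ⊔ ℓ)
UnitNonZero A = ∀ e → Identity _≈_ e _*_ → ¬ (0# ≈ e)
  where open SemiringWithoutOne A

module SumFactor {c ℓ} (A : SemiringWithoutOne c ℓ) where

  open SemiringWithoutOne A

  -- The carrier is a setoid, so a subset is a predicate compatible with _≈_.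
  record Subset (p : Level) : Set (c ⊔ ℓ ⊔ suc p) where
    field
      pred : Pred Carrier p
      resp : pred Respects _≈_

  open Subset public

  NonEmpty : ∀ {p} → Pred (Subset p) (c ⊔ p)
  NonEmpty B = Satisfiable (pred B)

  -- The library `sum` ends with a trailing 0#, which is harmless for n ≥ 1,
  -- the only case in which the sumset is meant to be used.
  _·_ : ∀ {p} → ℕ → Subset p → Subset (c ⊔ ℓ ⊔ p)
  n · C = record
    { pred = λ x → ∃[ v ] (∀ i → v i ∈ pred C) × x ≈ sum +-rawMonoid {n} v
    ; resp = λ { x≈y (v , v∈C , x≈) → v , v∈C , trans (sym x≈y) x≈ }
    }

  -- A non-empty list because there need not be a unit to serve as the
  -- empty product.
  FactorsIn : ∀ {p} → Subset p → Pred Carrier (c ⊔ ℓ ⊔ p)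
  FactorsIn C b = ∃[ cs ] All (pred C) cs × b ≈ foldr₁ _*_ cs

  module _ {p : Level} where

    -- Meant for non-empty C; then B ⊇ C makes B non-empty as well, so neither
    -- condition is repeated in the fields.
    record _⋗⇒[_]_ (B : Subset p) (n : ℕ) (C : Subset p) : Set (c ⊔ ℓ ⊔ p) where
      field
        contains : pred B ⊇ pred C
        sumset   : pred (n · B) ≐ pred (n · C)
        factors  : ∀ b → b ∈ pred B → b ∈ FactorsIn C

    𝓔 : ℕ → Subset p → Pred (Subset p) (c ⊔ ℓ ⊔ p)
    𝓔 n B D = D ⋗⇒[ n ] B

    -- 𝓔 n B ordered by inclusion, with equality of subsets being _≐_.
    𝓔-poset : ℕ → Subset p → Poset _ _ _
    𝓔-poset n B = On.poset ⊆-poset′ λ (D : Σ (Subset p) (𝓔 n B)) → pred (proj₁ D)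
      where ⊆-poset′ = ⊆-poset Carrier p

    -- 𝓔 n B = {B}, as an equality of sets of subsets.
    𝓕ue : ℕ → Pred (Subset p) _
    𝓕ue n B = NonEmpty B × (∀ D → D ∈ 𝓔 n B ⇔ pred D ≐ pred B)

{-# OPTIONS --safe #-}

-- Enlarging B to B ∪ U keeps B ∪ U in 𝓔 n B exactly when U consists of products
-- of elements of B and no n-fold sum over B ∪ U leaves n · B. An n-fold sum
-- involves finitely many elements, so these U are closed under unions of chains,
-- and Zorn's lemma gives a maximal one. As ⋗⇒[ n ] is transitive, an expansion of
-- an expansion D of B is again an expansion of B, so D is maximal iff unexpanded.
--
-- Zorn's lemma is proved by the Bourbaki–Witt tower argument. Subsets are taken
-- Bool-valued there: this makes the powerset predicative at the level of the
-- carrier, and under function extensionality subsets with the same elements are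
-- equal, so that a chosen enlargement depends only on the elements of a subset.
module Submission where

open import Defs
open import Level using (Level; Lift; lift; lower)
open import Algebra.Bundles using (SemiringWithoutOne)
open import Axiom.ExcludedMiddle using (ExcludedMiddle)
open import Axiom.Extensionality.Propositional using (Extensionality)
open import Data.Bool.Base using (Bool; T)
open import Data.Bool.Properties using (⇔→≡; T-≡)
open import Data.Fin.Base using (zero; suc)
open import Data.List.Base using ([]; _∷_)
open import Data.List.NonEmpty.Base using (_∷_; [_]; foldr₁; _⁺++⁺_)
open import Data.List.NonEmpty.Relation.Unary.All using (All; _∷_)
import Data.List.Relation.Unary.All as List
import Data.List.Relation.Unary.All.Properties as List
open import Data.Nat.Base using (ℕ; _≤_)
open import Data.Product.Base using (∃-syntax; _×_; _,_; proj₁; proj₂; swap)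
open import Data.Sum.Base using (_⊎_; inj₁; inj₂; [_,_]′; map₂)
open import Data.Vec.Functional using (Vector)
open import Function.Base using (_∘_; id)
open import Function.Bundles using (_⇔_; mk⇔; Equivalence)
open import Function.Construct.Composition using (_⇔-∘_)
open import Function.Construct.Symmetry using (⇔-sym)
open import Relation.Binary.Definitions using (_Respects_)
open import Relation.Binary.PropositionalEquality using (_≡_; subst)
open import Relation.Nullary.Decidable.Core
  using (Dec; yes; no; ⌊_⌋; toWitness; fromWitness)
open import Relation.Nullary.Negation.Core using (¬_; contradiction)
open import Relation.Unary using (Pred; Satisfiable; _∈_; _⊆_; _≐_; _∩_; _∪_)

-- Zorn's lemma for subsets ordered by inclusion.

module Zorn (em : ∀ {a} → ExcludedMiddle a) (ext : ∀ {a b} → Extensionality a b)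
            {x} {X : Set x} where

  Powerset : Set x
  Powerset = X → Bool

  ⟦_⟧ : Powerset → Pred X _
  ⟦ U ⟧ y = T (U y)

  Family : Set x
  Family = Powerset → Bool

  comprehension : ∀ {a q} {A : Set a} → Pred A q → A → Bool
  comprehension Q y = ⌊ em {P = Q y} ⌋

  ⋃ : Family → Powerset
  ⋃ S = comprehension λ y → ∃[ U ] T (S U) × y ∈ ⟦ U ⟧

  ⋃-upper : ∀ S {U} → T (S U) → ⟦ U ⟧ ⊆ ⟦ ⋃ S ⟧
  ⋃-upper S U∈S y∈U = fromWitness (_ , U∈S , y∈U)

  ⋃-least : ∀ S {q} {Q : Pred X q} → (∀ {U} → T (S U) → ⟦ U ⟧ ⊆ Q) → ⟦ ⋃ S ⟧ ⊆ Q
  ⋃-least S S⊆Q y∈⋃S with _ , U∈S , y∈U ← toWitness y∈⋃S = S⊆Q U∈S y∈U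

  ⊆-antisym : ∀ {U V} → ⟦ U ⟧ ⊆ ⟦ V ⟧ → ⟦ V ⟧ ⊆ ⟦ U ⟧ → U ≡ V
  ⊆-antisym U⊆V V⊆U =
    ext λ y → ⇔→≡ (T-≡ ⇔-∘ (mk⇔ U⊆V V⊆U ⇔-∘ ⇔-sym T-≡))

  Chain : Family → Set x
  Chain S = ∀ {U V} → T (S U) → T (S V) → ⟦ U ⟧ ⊆ ⟦ V ⟧ ⊎ ⟦ V ⟧ ⊆ ⟦ U ⟧

  module BourbakiWitt (f : Powerset → Powerset)
                      (inflationary : ∀ U → ⟦ U ⟧ ⊆ ⟦ f U ⟧) where

    -- The least family closed under `f` and arbitrary unions; the union of the empty subfamily
    -- starts it at the empty set.
    data Tower : Pred Powerset x where
      next  : ∀ {U} → Tower U → Tower (f U)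
      union : ∀ S → (∀ {U} → T (S U) → Tower U) → Tower (⋃ S)

    -- `f` never jumps out of `U` from a tower element strictly below it.
    Extremal : Pred Powerset x
    Extremal U = ∀ {V} → Tower V → ⟦ V ⟧ ⊆ ⟦ U ⟧ → ¬ ⟦ U ⟧ ⊆ ⟦ V ⟧ → ⟦ f V ⟧ ⊆ ⟦ U ⟧

    -- `f` need not be monotone, but mutually included subsets are equal by extensionality.
    f-mono-≐ : ∀ {U V} → ⟦ U ⟧ ⊆ ⟦ V ⟧ → ⟦ V ⟧ ⊆ ⟦ U ⟧ → ⟦ f U ⟧ ⊆ ⟦ f V ⟧
    f-mono-≐ U⊆V V⊆U {y} = subst (λ W → y ∈ ⟦ f W ⟧) (⊆-antisym U⊆V V⊆U)

    -- Induction on the tower. If `V` lies in `U`, then either the two agree and `f V` contains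
    -- `f U`, or extremality puts `f V` inside `U`. A union contains `f U` as soon as one member
    -- does; otherwise all members lie in `U`.
    extremal-separates : ∀ {U V} → Extremal U → Tower V →
                         ⟦ V ⟧ ⊆ ⟦ U ⟧ ⊎ ⟦ f U ⟧ ⊆ ⟦ V ⟧
    extremal-separates {U} extU (next {V} V∈T) with extremal-separates extU V∈T
    ... | inj₂ fU⊆V = inj₂ (inflationary V ∘ fU⊆V)
    ... | inj₁ V⊆U with em {P = ⟦ U ⟧ ⊆ ⟦ V ⟧}
    ...   | yes U⊆V = inj₂ (f-mono-≐ U⊆V V⊆U)
    ...   | no  U⊈V = inj₁ (extU V∈T V⊆U U⊈V)
    extremal-separates {U} extU (union S S⊆T)
      with em {P = ∃[ V ] T (S V) × ⟦ f U ⟧ ⊆ ⟦ V ⟧}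
    ... | yes (_ , V∈S , fU⊆V) = inj₂ (⋃-upper S V∈S ∘ fU⊆V)
    ... | no  none = inj₁ (⋃-least S λ V∈S →
            [ id , (λ fU⊆V → contradiction (_ , V∈S , fU⊆V) none) ]′
              (extremal-separates extU (S⊆T V∈S)))

    tower-extremal : ∀ {U} → Tower U → Extremal U
    tower-extremal (next {U} U∈T) {V} V∈T V⊆fU fU⊈V
      with extremal-separates (tower-extremal U∈T) V∈T
    ... | inj₂ fU⊆V = contradiction (λ {y} → fU⊆V {y}) fU⊈V
    ... | inj₁ V⊆U with em {P = ⟦ U ⟧ ⊆ ⟦ V ⟧}
    ...   | yes U⊆V = f-mono-≐ V⊆U U⊆V
    ...   | no  U⊈V = inflationary U ∘ tower-extremal U∈T V∈T V⊆U U⊈V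
    tower-extremal (union S S⊆T) {V} V∈T V⊆⋃S ⋃S⊈V
      with em {P = ∃[ U ] T (S U) × ¬ ⟦ U ⟧ ⊆ ⟦ V ⟧}
    ... | no  none = contradiction (λ {y} → ⋃-least S below {y}) ⋃S⊈V
      where
      below : ∀ {U} → T (S U) → ⟦ U ⟧ ⊆ ⟦ V ⟧
      below {U} U∈S with em {P = ⟦ U ⟧ ⊆ ⟦ V ⟧}
      ... | yes U⊆V = U⊆V
      ... | no  U⊈V = contradiction (U , U∈S , U⊈V) none
    -- `V` lies in this member `U`, since `f U` inside `V` would force `U` inside `V`; extremality
    -- of `U` then applies.
    ... | yes (U , U∈S , U⊈V)
      with extremal-separates (tower-extremal (S⊆T U∈S)) V∈T
    ...   | inj₁ V⊆U  = ⋃-upper S U∈S ∘ tower-extremal (S⊆T U∈S) V∈T V⊆U U⊈V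
    ...   | inj₂ fU⊆V = contradiction (λ {y} → fU⊆V {y} ∘ inflationary U) U⊈V

    tower-comparable : ∀ {U V} → Tower U → Tower V → ⟦ U ⟧ ⊆ ⟦ V ⟧ ⊎ ⟦ V ⟧ ⊆ ⟦ U ⟧
    tower-comparable {U} U∈T V∈T with extremal-separates (tower-extremal U∈T) V∈T
    ... | inj₁ V⊆U  = inj₂ V⊆U
    ... | inj₂ fU⊆V = inj₁ (fU⊆V ∘ inflationary U)

    -- The union of the whole tower is again in the tower, and so is its successor, which therefore
    -- lies inside that union.
    fixedPoint : ∃[ U ] Tower U × ⟦ f U ⟧ ⊆ ⟦ U ⟧
    fixedPoint = ⋃ towers , top∈T , ⋃-upper towers (fromWitness (next top∈T))
      where
      towers : Family
      towers = comprehension Tower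

      top∈T : Tower (⋃ towers)
      top∈T = union towers toWitness

  -- The empty family is a chain, so the closure hypothesis also makes `Q` inhabited. Where the
  -- chosen enlargement adds nothing, no strictly larger subset satisfies `Q`.
  zorn : ∀ {q} (Q : Pred Powerset q) →
         (∀ S → Chain S → (∀ {U} → T (S U) → Q U) → Q (⋃ S)) →
         ∃[ U ] Q U × (∀ V → Q V → ⟦ U ⟧ ⊆ ⟦ V ⟧ → ⟦ V ⟧ ⊆ ⟦ U ⟧)
  zorn Q chain-closed = M , tower-Q M∈T , maximal
    where
    Enlargement : Powerset → Set _
    Enlargement U = ∃[ V ] Q V × ⟦ U ⟧ ⊆ ⟦ V ⟧ × ¬ ⟦ V ⟧ ⊆ ⟦ U ⟧

    -- The decision is a separate argument so that the lemmas about `enlarge` can split on it.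
    enlarge : ∀ U → Dec (Enlargement U) → Powerset
    enlarge U (yes (V , _)) = V
    enlarge U (no _)        = U

    enlarge-inflationary : ∀ U d → ⟦ U ⟧ ⊆ ⟦ enlarge U d ⟧
    enlarge-inflationary U (yes (_ , _ , U⊆V , _)) = U⊆V
    enlarge-inflationary U (no _)                  = id

    enlarge-Q : ∀ {U} d → Q U → Q (enlarge U d)
    enlarge-Q (yes (_ , QV , _)) _  = QV
    enlarge-Q (no _)             QU = QU

    enlarge-fixed : ∀ {U} d → ⟦ enlarge U d ⟧ ⊆ ⟦ U ⟧ → ¬ Enlargement U
    enlarge-fixed (yes (_ , _ , _ , V⊈U)) V⊆U _ = V⊈U V⊆U
    enlarge-fixed (no none) _                   = none

    open BourbakiWitt (λ U → enlarge U em) (λ U → enlarge-inflationary U em)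

    tower-Q : ∀ {U} → Tower U → Q U
    tower-Q (next U∈T)    = enlarge-Q em (tower-Q U∈T)
    tower-Q (union S S⊆T) =
      chain-closed S (λ U∈S V∈S → tower-comparable (S⊆T U∈S) (S⊆T V∈S))
                     (λ U∈S → tower-Q (S⊆T U∈S))

    M   = proj₁ fixedPoint
    M∈T = proj₁ (proj₂ fixedPoint)

    maximal : ∀ V → Q V → ⟦ M ⟧ ⊆ ⟦ V ⟧ → ⟦ V ⟧ ⊆ ⟦ M ⟧
    maximal V QV M⊆V with em {P = ⟦ V ⟧ ⊆ ⟦ M ⟧}
    ... | yes V⊆M = V⊆M
    ... | no  V⊈M = contradiction (V , QV , (λ {y} → M⊆V {y}) , V⊈M)
                      (enlarge-fixed em (proj₂ (proj₂ fixedPoint)))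

  -- The finitely many entries outside `Q` come from finitely many members of the chain, the largest
  -- of which holds them all. The first alternative covers the empty chain.
  chain-captures : ∀ {S} → Chain S → ∀ {q} (Q : Pred X q) {n} (v : Vector X n) →
                   (∀ i → v i ∈ Q ∪ ⟦ ⋃ S ⟧) →
                   (∀ i → v i ∈ Q) ⊎ ∃[ U ] T (S U) × (∀ i → v i ∈ Q ∪ ⟦ U ⟧)
  chain-captures chain Q {ℕ.zero}  v v∈ = inj₁ λ ()
  chain-captures chain Q {ℕ.suc n} v v∈
    with chain-captures chain Q (v ∘ suc) (v∈ ∘ suc) | map₂ toWitness (v∈ zero)
  ... | inj₁ vs∈Q              | inj₁ v₀∈Q =
    inj₁ λ { zero → v₀∈Q ; (suc i) → vs∈Q i }
  ... | inj₁ vs∈Q              | inj₂ (U , U∈S , v₀∈U) =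
    inj₂ (U , U∈S , λ { zero → inj₂ v₀∈U ; (suc i) → inj₁ (vs∈Q i) })
  ... | inj₂ (U , U∈S , vs∈U)  | inj₁ v₀∈Q =
    inj₂ (U , U∈S , λ { zero → inj₁ v₀∈Q ; (suc i) → vs∈U i })
  ... | inj₂ (V , V∈S , vs∈V)  | inj₂ (U , U∈S , v₀∈U) with chain U∈S V∈S
  ...   | inj₁ U⊆V =
    inj₂ (V , V∈S , λ { zero → inj₂ (U⊆V v₀∈U) ; (suc i) → vs∈V i })
  ...   | inj₂ V⊆U =
    inj₂ (U , U∈S , λ { zero → inj₂ v₀∈U ; (suc i) → map₂ V⊆U (vs∈V i) })

-- Transitivity of the expansion relation, and unexpanded sets.

module Expansion {c ℓ} (A : SemiringWithoutOne c ℓ) where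

  open SemiringWithoutOne A renaming (refl to ≈-refl; sym to ≈-sym; trans to ≈-trans)
  open SumFactor A

  foldr₁-⁺++⁺ : ∀ x xs ys → foldr₁ _*_ ((x ∷ xs) ⁺++⁺ ys) ≈
                             foldr₁ _*_ (x ∷ xs) * foldr₁ _*_ ys
  foldr₁-⁺++⁺ x []       ys = ≈-refl
  foldr₁-⁺++⁺ x (y ∷ xs) ys =
    ≈-trans (*-cong ≈-refl (foldr₁-⁺++⁺ y xs ys)) (≈-sym (*-assoc x _ _))

  module _ {p : Level} where

    factors-∈ : (C : Subset p) → pred C ⊆ FactorsIn C
    factors-∈ C {x} x∈C = [ x ] , x∈C ∷ List.[] , ≈-refl

    factors-* : (C : Subset p) → ∀ {x y} →
                x ∈ FactorsIn C → y ∈ FactorsIn C → x * y ∈ FactorsIn C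
    factors-* C (z ∷ zs , x∈C ∷ zs∈C , x≈) (ys@(_ ∷ _) , y∈C ∷ ys∈C , y≈) =
      (z ∷ zs) ⁺++⁺ ys , x∈C ∷ List.++⁺ zs∈C (y∈C List.∷ ys∈C) ,
      ≈-trans (*-cong x≈ y≈) (≈-sym (foldr₁-⁺++⁺ z zs ys))

    factors-resp : (C : Subset p) → FactorsIn C Respects _≈_
    factors-resp C x≈y (xs , xs∈C , x≈) = xs , xs∈C , ≈-trans (≈-sym x≈y) x≈

    factors-mono : (C D : Subset p) → pred C ⊆ pred D → FactorsIn C ⊆ FactorsIn D
    factors-mono C D C⊆D (xs@(_ ∷ _) , x∈C ∷ xs∈C , x≈) =
      xs , C⊆D x∈C ∷ List.map C⊆D xs∈C , x≈

    -- Replace each factor by its own factorization and concatenate; this makes the factor property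
    -- transitive.
    factors-flatten : (C D : Subset p) → pred D ⊆ FactorsIn C →
                      FactorsIn D ⊆ FactorsIn C
    factors-flatten C D D⊆ (xs@(_ ∷ _) , x∈D ∷ xs∈D , x≈) =
      factors-resp C (≈-sym x≈) (product x∈D xs∈D)
      where
      product : ∀ {x xs} → x ∈ pred D → List.All (pred D) xs →
                foldr₁ _*_ (x ∷ xs) ∈ FactorsIn C
      product x∈D List.[]            = D⊆ x∈D
      product x∈D (y∈D List.∷ xs∈D) = factors-* C (D⊆ x∈D) (product y∈D xs∈D)

    ·-mono : ∀ n (C D : Subset p) → pred C ⊆ pred D → pred (n · C) ⊆ pred (n · D)
    ·-mono n C D C⊆D (v , v∈C , x≈) = v , C⊆D ∘ v∈C , x≈

    open _⋗⇒[_]_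

    ⋗⇒-reflexive : ∀ {n} {C D : Subset p} → pred D ≐ pred C → D ⋗⇒[ n ] C
    ⋗⇒-reflexive {n} {C} {D} (D⊆C , C⊆D) = record
      { contains = C⊆D
      ; sumset   = ·-mono n D C D⊆C , ·-mono n C D C⊆D
      ; factors  = λ _ → factors-∈ C ∘ D⊆C
      }

    ⋗⇒-trans : ∀ {n} {B C D : Subset p} → D ⋗⇒[ n ] C → C ⋗⇒[ n ] B → D ⋗⇒[ n ] B
    ⋗⇒-trans {n} {B} {C} {D} D⋗C C⋗B = record
      { contains = contains D⋗C ∘ contains C⋗B
      ; sumset   = proj₁ (sumset C⋗B) ∘ proj₁ (sumset D⋗C)
                 , proj₂ (sumset D⋗C) ∘ proj₂ (sumset C⋗B)
      ; factors  = λ x → factors-flatten B C (factors C⋗B _) ∘ factors D⋗C x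
      }

    -- `C` and `D` both have the n-fold sumset of `B`, and a factorization over `B` is one over the
    -- larger `C`.
    ⋗⇒-relative : ∀ {n} {B C D : Subset p} → pred C ⊆ pred D →
                  C ⋗⇒[ n ] B → D ⋗⇒[ n ] B → D ⋗⇒[ n ] C
    ⋗⇒-relative {n} {B} {C} {D} C⊆D C⋗B D⋗B = record
      { contains = C⊆D
      ; sumset   = proj₂ (sumset C⋗B) ∘ proj₁ (sumset D⋗B) , ·-mono n C D C⊆D
      ; factors  = λ x → factors-mono B C (contains C⋗B) ∘ factors D⋗B x
      }

    maximal⇔unexpanded : ∀ {n} {B : Subset p} → NonEmpty B →
      ∀ D → D ∈ Maximal (𝓔-poset n B) ⇔ proj₁ D ∈ 𝓔 n B ∩ 𝓕ue n
    maximal⇔unexpanded (b , b∈B) (D , D⋗B) = mk⇔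
      (λ maximal → D⋗B , (b , contains D⋗B b∈B) , λ E → mk⇔
        (λ E⋗D → swap (maximal (E , ⋗⇒-trans E⋗D D⋗B) (contains E⋗D)))
        ⋗⇒-reflexive)
      -- Conversely, a member of `𝓔 n B` above `D` is an expansion of `D`, hence equals `D`.
      (λ { (_ , _ , unexpanded) (E , E⋗B) D⊆E →
        D⊆E , proj₁ (Equivalence.to (unexpanded E) (⋗⇒-relative D⊆E D⋗B E⋗B)) })

    -- Existence of a maximal expansion.

    module _ (em : ∀ {a} → ExcludedMiddle a) (ext : ∀ {a b} → Extensionality a b)
             (n : ℕ) (B : Subset p) where

      open Zorn em ext {X = Carrier}

      -- `U` is the part adjoined to `B` and may omit elements of `B`; so the empty set qualifies,
      -- as the union of the empty chain must. `Lift` brings the Boolean-valued `U` to the level of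
      -- `B`.
      record Admissible (U : Powerset) : Set (c Level.⊔ ℓ Level.⊔ p) where
        field
          respects : ⟦ U ⟧ Respects _≈_

        adjoin : Subset p
        adjoin = record
          { pred = pred B ∪ (Lift p ∘ ⟦ U ⟧)
          ; resp = λ { x≈y (inj₁ x∈B)        → inj₁ (resp B x≈y x∈B)
                     ; x≈y (inj₂ (lift x∈U)) → inj₂ (lift (respects x≈y x∈U)) }
          }

        field
          products : ⟦ U ⟧ ⊆ FactorsIn B
          sums     : pred (n · adjoin) ⊆ pred (n · B)

      open Admissible

      admissible-⋃ : ∀ S → Chain S → (∀ {U} → T (S U) → Admissible U) →
                     Admissible (⋃ S)
      admissible-⋃ S chain S⊆ = record
        { respects = λ x≈y x∈⋃S → ⋃-least S {Q = λ x → ∀ {y} → x ≈ y → y ∈ ⟦ ⋃ S ⟧}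
            (λ U∈S x∈U x≈y → ⋃-upper S U∈S (respects (S⊆ U∈S) x≈y x∈U)) x∈⋃S x≈y
        ; products = ⋃-least S (λ U∈S → products (S⊆ U∈S))
        -- The summands all lie in `B`, or in `B` together with a single member of the chain, whose
        -- own `sums` applies.
        ; sums     = λ { (v , v∈ , x≈) →
            [ (λ v∈B → v , v∈B , x≈)
            , (λ { (U , U∈S , v∈U) → sums (S⊆ U∈S) (v , map₂ lift ∘ v∈U , x≈) })
            ]′ (chain-captures chain (pred B) v (map₂ lower ∘ v∈)) }
        }

      admissible⇒⋗⇒ : ∀ {U} (adm : Admissible U) → adjoin adm ⋗⇒[ n ] B
      admissible⇒⋗⇒ adm = record
        { contains = inj₁
        ; sumset   = sums adm , ·-mono n B (adjoin adm) inj₁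
        ; factors  = λ _ → [ factors-∈ B , products adm ∘ lower ]′
        }

      -- `D` contains `B`, so adjoining `D` to `B` gives back `D`.
      ⋗⇒⇒admissible : ∀ {D} → D ⋗⇒[ n ] B → Admissible (comprehension (pred D))
      ⋗⇒⇒admissible {D} D⋗B = record
        { respects = λ x≈y x∈D → fromWitness (resp D x≈y (toWitness x∈D))
        ; products = λ x∈D → factors D⋗B _ (toWitness x∈D)
        ; sums     = λ { (v , v∈ , x≈) → proj₁ (sumset D⋗B)
            (v , (λ i → [ contains D⋗B , toWitness ∘ lower ]′ (v∈ i)) , x≈) }
        }

      maximal-exists : Satisfiable (Maximal (𝓔-poset n B))
      maximal-exists with M , adm , maximal ← zorn Admissible admissible-⋃ =
        (adjoin adm , admissible⇒⋗⇒ adm) , λ { (E , E⋗B) D⊆E →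
          -- The Boolean copy of `E` is admissible and contains `M`, so maximality puts all of `E`
          -- inside `M`.
          D⊆E , λ x∈E → inj₂ (lift
            (maximal _ (⋗⇒⇒admissible E⋗B)
              (λ y∈M → fromWitness (D⊆E (inj₂ (lift y∈M)))) (fromWitness x∈E))) }

theorem2p7 : (∀ {a} → ExcludedMiddle a) → (∀ {a b} → Extensionality a b) →
    ∀ {c ℓ p} (A : SemiringWithoutOne c ℓ) → UnitNonZero A →
    let open SumFactor A in
    (B : Subset p) → NonEmpty B → (n : ℕ) → 2 ≤ n →
    Satisfiable (Maximal (𝓔-poset n B))
    × Satisfiable (𝓔 n B ∩ 𝓕ue n)
    × (∀ D → D ∈ Maximal (𝓔-poset n B) ⇔ proj₁ D ∈ 𝓔 n B ∩ 𝓕ue n)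
theorem2p7 em ext A _ B B≠∅ n _ =
  (D , D-maximal) ,
  (proj₁ D , Equivalence.to (maximal⇔unexpanded B≠∅ D) D-maximal) ,
  maximal⇔unexpanded B≠∅
  where
  open Expansion A
  D         = proj₁ (maximal-exists em ext n B)
  D-maximal = proj₂ (maximal-exists em ext n B)
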